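{- Let $H$ be a graph and let $v_0$ be a vertex of $H$. Then the following two conditions are equivalent. (1) For any graph $G$, the graph $G[H;\{v_0\}]$ is well-covered and shellable. (2) $H$ is well-covered, both $H$ and $H \setminus \{v_0\}$ are shellable, and for any maximal independent set $\tau$ of $H \setminus \{v_0\}$ there exists $v \in \tau$ such that $\{v_0, v\} \in E(H)$.
   Context: All graphs are finite and simple: $G=(V(G),E(G))$ with $V(G)$ a finite set and $E(G)\subset\{e\subset V(G) : |e|=2\}$. A set $\sigma\subset V(G)$ is independent if $\{u,v\}\notin E(G)$ for all $u,v\in\sigma$. The independence complex $I(G)$ is the simplicial complex on $V(G)$ whose simplices are the independent sets of $G$. A graph is well-covered if all its maximal (with respect to inclusion) independent sets have the same cardinality. A simplicial complex $K$ is shellable (in the non-pure sense) if its facets (inclusion-maximal simplices) can be arranged in a linear order $F_1,\dots,F_t$ such that for all $k=2,\dots,t$ the subcomplex $\left(\bigcup_{i=1}^{k-1}\langle F_i\rangle\right)\cap\langle F_k\rangle$ is pure and $(\dim F_k-1)$-dimensional, where $\langle F\rangle$ is the complex of all subsets of $F$, $\dim F=|F|-1$, and pure means that all facets have the same cardinality. A graph is shellable if its independence complex is shellable. $H\setminus\{v_0\}$ is the induced subgraph of $H$ on $V(H)\setminus\{v_0\}$ (if $V(H)=\{v_0\}$ it is the graph with no vertices, whose independence complex is $\{\emptyset\}$). For graphs $G$, $H$ and $v_0\in V(H)$, $G[H;\{v_0\}]$ is the graph obtained from $G\sqcup\bigsqcup_{u\in V(G)}H_u$, where each $H_u$ is a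 copy of $H$, by identifying, for each $u\in V(G)$, the vertex $u$ of $G$ with the vertex $v_0$ of $H_u$. Equivalently, its vertex set is $V(G)\times V(H)$, and $(u_1,v_1),(u_2,v_2)$ are adjacent if and only if either $u_1=u_2$ and $\{v_1,v_2\}\in E(H)$, or $\{u_1,u_2\}\in E(G)$ and $v_1=v_2=v_0$. -}

module Defs where

open import Data.Nat.Base as ℕ using (ℕ; suc)
open import Data.Integer.Base as ℤ using (ℤ; +_; 1ℤ)
open import Data.Fin.Base as Fin using (Fin; toℕ; punchIn; remQuot)
import Data.Fin.Properties as Fin
open import Data.Fin.Subset using (Subset; _∈_; _⊆_; ∣_∣)
open import Data.Fin.Subset.Properties using (⊆-trans)
open import Data.Product using (_×_; _,_; ∃; ∃-syntax)
open import Data.Sum using (_⊎_; inj₁; inj₂)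
open import Function.Base using (_on_)
open import Function.Definitions using (Injective)
open import Level using (0ℓ)
open import Relation.Binary.Core using (Rel)
open import Relation.Binary.Definitions using (Symmetric; Irreflexive; Decidable)
open import Relation.Binary.PropositionalEquality using (_≡_; refl; sym)
open import Relation.Nullary using (¬_)
open import Relation.Nullary.Decidable using (_×-dec_; _⊎-dec_)
open import Relation.Unary using (Pred)

private
  variable
    m n : ℕ

Maximal : Pred (Subset n) 0ℓ → Pred (Subset n) 0ℓ
Maximal P σ = P σ × (∀ τ → P τ → σ ⊆ τ → σ ≡ τ)

-- Elements of Fin n need not be vertices of the complex, so that ⟨ F ⟩ and
-- its unions and intersections live on the same ground set.
record SimplicialComplex (n : ℕ) : Set₁ where
  field
    Face   : Pred (Subset n) 0ℓ
    closed : ∀ {σ τ} → τ ⊆ σ → Face σ → Face τ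

open SimplicialComplex public using (Face)

Facet : SimplicialComplex n → Pred (Subset n) 0ℓ
Facet K = Maximal (Face K)

⟨_⟩ : Subset n → SimplicialComplex n
⟨ F ⟩ = record { Face = _⊆ F ; closed = ⊆-trans }

⋃ : {I : Set} → (I → SimplicialComplex n) → SimplicialComplex n
⋃ K = record
  { Face   = λ σ → ∃[ i ] Face (K i) σ
  ; closed = λ { τ⊆σ (i , f) → i , SimplicialComplex.closed (K i) τ⊆σ f }
  }

_∩ᶜ_ : SimplicialComplex n → SimplicialComplex n → SimplicialComplex n
K ∩ᶜ L = record
  { Face   = λ σ → Face K σ × Face L σ
  ; closed = λ { τ⊆σ (f , g) → SimplicialComplex.closed K τ⊆σ f
                             , SimplicialComplex.closed L τ⊆σ g }
  }

dim : Subset n → ℤ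
dim σ = + ∣ σ ∣ ℤ.- 1ℤ

HasDimension : SimplicialComplex n → ℤ → Set
HasDimension K d = (∃[ σ ] Face K σ × dim σ ≡ d) × (∀ σ → Face K σ → dim σ ℤ.≤ d)

Pure : SimplicialComplex n → Set
Pure K = ∀ σ τ → Facet K σ → Facet K τ → ∣ σ ∣ ≡ ∣ τ ∣

-- ⋃_{i<k} ⟨ F i ⟩
before : ∀ {t} → (Fin t → Subset n) → Fin t → SimplicialComplex n
before F k = ⋃ {I = ∃[ i ] i Fin.< k} λ { (i , _) → ⟨ F i ⟩ }

-- Facets are listed as F 0, …, F (t - 1), so the condition is imposed for
-- every index other than 0.
record Shelling (K : SimplicialComplex n) : Set where
  field
    t           : ℕ
    F           : Fin t → Subset n
    facet       : ∀ i → Facet K (F i)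
    distinct    : Injective _≡_ _≡_ F
    exhaustive  : ∀ σ → Facet K σ → ∃[ i ] F i ≡ σ
    pure        : ∀ k → 0 ℕ.< toℕ k → Pure (before F k ∩ᶜ ⟨ F k ⟩)
    codimension : ∀ k → 0 ℕ.< toℕ k →
                  HasDimension (before F k ∩ᶜ ⟨ F k ⟩) (dim (F k) ℤ.- 1ℤ)

-- Finite simple graphs, with vertex set Fin n.  Decidability of adjacency
-- says that the edges form a finite set in the constructive sense.
record Graph (n : ℕ) : Set₁ where
  field
    Adj    : Rel (Fin n) 0ℓ
    adj?   : Decidable Adj
    symm   : Symmetric Adj
    irrefl : Irreflexive _≡_ Adj

open Graph public using (Adj)

Independent : Graph n → Pred (Subset n) 0ℓ
Independent G σ = ∀ {u v} → u ∈ σ → v ∈ σ → ¬ Adj G u v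

MaximalIndependent : Graph n → Pred (Subset n) 0ℓ
MaximalIndependent G = Maximal (Independent G)

independenceComplex : Graph n → SimplicialComplex n
independenceComplex G = record
  { Face   = Independent G
  ; closed = λ τ⊆σ ind u∈τ v∈τ → ind (τ⊆σ u∈τ) (τ⊆σ v∈τ)
  }

WellCovered : Graph n → Set
WellCovered G = ∀ σ τ → MaximalIndependent G σ → MaximalIndependent G τ → ∣ σ ∣ ≡ ∣ τ ∣

Shellable : Graph n → Set
Shellable G = Shelling (independenceComplex G)

-- The induced subgraph on the complement of v₀, relabelled along the
-- bijection punchIn v₀ : Fin n → Fin (suc n) ∖ {v₀}.
_∖_ : Graph (suc n) → Fin (suc n) → Graph n
H ∖ v₀ = record
  { Adj    = Adj H on punchIn v₀
  ; adj?   = λ u v → Graph.adj? H (punchIn v₀ u) (punchIn v₀ v)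
  ; symm   = Graph.symm H
  ; irrefl = λ { refl → Graph.irrefl H refl }
  }

GluedAdj : Graph m → (H : Graph n) → Fin n → Rel (Fin m × Fin n) 0ℓ
GluedAdj G H v₀ (u₁ , v₁) (u₂ , v₂) =
  (u₁ ≡ u₂ × Adj H v₁ v₂) ⊎ (Adj G u₁ u₂ × v₁ ≡ v₀ × v₂ ≡ v₀)

-- G[H;{v₀}], its vertex set Fin m × Fin n being identified with Fin (m * n)
-- along the bijection remQuot n.
_[_⨾_] : Graph m → Graph n → Fin n → Graph (m ℕ.* n)
_[_⨾_] {n = n} G H v₀ = record
  { Adj    = GluedAdj G H v₀ on remQuot n
  ; adj?   = λ p q → glued? (remQuot n p) (remQuot n q)
  ; symm   = λ { (inj₁ (e , a))     → inj₁ (sym e , Graph.symm H a)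
               ; (inj₂ (a , e , f)) → inj₂ (Graph.symm G a , f , e) }
  ; irrefl = λ { refl (inj₁ (_ , a)) → Graph.irrefl H refl a
               ; refl (inj₂ (a , _)) → Graph.irrefl G refl a }
  }
  where
  glued? : Decidable (GluedAdj G H v₀)
  glued? (u₁ , v₁) (u₂ , v₂) =
    ((u₁ Fin.≟ u₂) ×-dec Graph.adj? H v₁ v₂)
      ⊎-dec (Graph.adj? G u₁ u₂ ×-dec ((v₁ Fin.≟ v₀) ×-dec (v₂ Fin.≟ v₀)))

{-# OPTIONS --safe #-}
module Submission where

-- A shelling amounts to an order of the facets with the exchange property: for
-- i < k there are j < k and x ∈ F k ∖ F i with F k - x ⊆ F j.
--
-- (2) ⇒ (1): the maximal independent sets of G[H;{v₀}] are the families
-- (σ u) of maximal independent sets of H, indexed by the vertices u of G, in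
-- which the u with v₀ ∈ σ u form an independent set of G.  List the facets of H
-- avoiding v₀ first, then those containing v₀, and order families
-- lexicographically.
--
-- (1) ⇒ (2): the path on three vertices forces the neighbour condition, a
-- single vertex gives the properties of H, and over an edge the link of a facet
-- ρ ∋ v₀ of one copy of H is the independence complex of H ∖ v₀ in the other.

open import Data.Nat.Base as ℕ using (ℕ; zero; suc; s≤s; z≤n; _+_; _*_; _^_)
import Data.Nat.Properties as ℕ
open import Data.Integer.Base as ℤ using (+_; 1ℤ)
import Data.Integer.Properties as ℤ
open import Data.Fin.Base as Fin
  using (Fin; zero; suc; toℕ; punchIn; punchOut; combine; splitAt; join; finToFun; funToFin)
import Data.Fin.Properties as Fin
open import Data.Fin.Subset
  using (Subset; Side; inside; outside; _∈_; _∉_; _⊆_; _⊂_; _∩_; _∪_; _-_; ∣_∣; ⁅_⁆; ⊥)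
open import Data.Fin.Subset.Induction using (⊃-wellFounded; Acc; acc)
open import Data.Fin.Subset.Properties
  using ( _∈?_; _⊆?_; _⊂?_; anySubset?; ⊆-antisym; ⊆-reflexive; p⊂q⇒∣p∣<∣q∣; p⊆q⇒∣p∣≤∣q∣
        ; p─⊥≡p; p─q⊆p; x∈p∧x≢y⇒x∈p-y; x∈p∩q⁺; x∈p∩q⁻; x∈p∪q⁺; x∈p∪q⁻; x∈⁅x⁆; x∈⁅y⁆⇒x≡y; p⊆p∪q; ∉⊥)
open import Data.Vec.Base as Vec using ([]; _∷_; here; there; tabulate; lookup; insertAt; concat)
open import Data.Vec.Properties
  using ([]=⇒lookup; lookup⇒[]=; lookup∘tabulate; insertAt-lookup; insertAt-punchIn; lookup-concat; tabulate-cong)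
open import Data.Product using (_×_; _,_; ∃; ∃-syntax; proj₁; proj₂)
open import Data.Sum using (_⊎_; inj₁; inj₂; [_,_]′)
open import Data.Unit.Base using (⊤; tt)
open import Function.Base using (_∘_; id)
open import Function.Bundles using (_⇔_; mk⇔)
open import Function.Definitions using (Injective)
open import Level using (0ℓ)
open import Relation.Binary.Definitions using (tri<; tri≈; tri>)
open import Relation.Binary.PropositionalEquality
  using (_≡_; _≢_; refl; sym; trans; cong; cong₂; subst; subst₂; module ≡-Reasoning)
open import Relation.Nullary using (¬_; yes; no; contradiction)
open import Relation.Nullary.Decidable using (_×-dec_; _⊎-dec_; _→-dec_; ¬?; map′; decidable-stable)
open import Algebra.Bundles using (AbelianGroup)
open import Algebra.Properties.Group (AbelianGroup.group ℤ.+-0-abelianGroup) using (∙-cancelʳ)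
open import Relation.Unary using (Pred; Decidable)
open import Defs

private
  variable
    m n : ℕ

-- Maximal subsets, removal of a point, and preimages

-- Decidability of `P` lets a strictly larger set with `P` be searched for, and proper enlargement
-- terminates on a finite ground set.
extend-maximal : {P : Pred (Subset n) 0ℓ} → Decidable P →
                 ∀ {σ} → P σ → ∃[ τ ] (σ ⊆ τ × Maximal P τ)
extend-maximal {P = P} P? {σ} = go σ (⊃-wellFounded σ)
  where
  go : ∀ σ → Acc (λ p q → q ⊂ p) σ → P σ → ∃[ τ ] (σ ⊆ τ × Maximal P τ)
  go σ (acc rs) pσ with anySubset? (λ τ → P? τ ×-dec (σ ⊂? τ))
  ... | yes (τ , pτ , σ⊂τ) with go τ (rs σ⊂τ) pτ
  ...   | υ , τ⊆υ , max = υ , τ⊆υ ∘ proj₁ σ⊂τ , max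
  go σ (acc rs) pσ | no ∄ = σ , id , pσ , λ τ pτ σ⊆τ →
    ⊆-antisym σ⊆τ λ {x} x∈τ → decidable-stable (x ∈? σ)
      λ x∉σ → ∄ (τ , pτ , σ⊆τ , x , x∈τ , x∉σ)

⊆∧∣∣≥⇒≡ : {p q : Subset n} → p ⊆ q → ∣ q ∣ ℕ.≤ ∣ p ∣ → p ≡ q
⊆∧∣∣≥⇒≡ {p = p} p⊆q ≤ = ⊆-antisym p⊆q λ {x} x∈q → decidable-stable (x ∈? p)
  λ x∉p → ℕ.<⇒≱ (p⊂q⇒∣p∣<∣q∣ (p⊆q , x , x∈q , x∉p)) ≤

∣p∣≡1+∣p-x∣ : {p : Subset n} {x : Fin n} → x ∈ p → ∣ p ∣ ≡ suc ∣ p - x ∣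
∣p∣≡1+∣p-x∣ {p = _ ∷ p}       here      = cong (suc ∘ ∣_∣) (sym (p─⊥≡p p))
∣p∣≡1+∣p-x∣ {p = inside ∷ p}  (there i) = cong suc (∣p∣≡1+∣p-x∣ i)
∣p∣≡1+∣p-x∣ {p = outside ∷ p} (there i) = ∣p∣≡1+∣p-x∣ i

x∉p-x : (p : Subset n) (x : Fin n) → x ∉ p - x
x∉p-x (inside ∷ p)  zero    ()
x∉p-x (outside ∷ p) zero    ()
x∉p-x (s ∷ p)       (suc x) (there i) = x∉p-x p x i

p-x⊆q : {p q : Subset n} (x : Fin n) → (∀ {y} → y ∈ p → y ≢ x → y ∈ q) → p - x ⊆ q
p-x⊆q {p = p} x f y∈ = f (p─q⊆p p ⁅ x ⁆ y∈) λ { refl → x∉p-x p x y∈ }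

∉-⊆⇒⊆- : {p q : Subset n} {x : Fin n} → x ∉ p → p ⊆ q → p ⊆ q - x
∉-⊆⇒⊆- x∉p p⊆q y∈p = x∈p∧x≢y⇒x∈p-y (p⊆q y∈p) λ { refl → x∉p y∈p }

-- Restriction of a face along a relabelling; deletions, slices and links are all instances.
preimage : (Fin m → Fin n) → Subset n → Subset m
preimage e σ = tabulate (lookup σ ∘ e)

∈-preimage⁺ : (e : Fin m → Fin n) (σ : Subset n) → ∀ {x} → e x ∈ σ → x ∈ preimage e σ
∈-preimage⁺ e σ {x} p = lookup⇒[]= x _ (trans (lookup∘tabulate _ x) ([]=⇒lookup p))

∈-preimage⁻ : (e : Fin m → Fin n) (σ : Subset n) → ∀ {x} → x ∈ preimage e σ → e x ∈ σ
∈-preimage⁻ e σ {x} p = lookup⇒[]= (e x) σ (trans (sym (lookup∘tabulate _ x)) ([]=⇒lookup p))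

-- Shellings and the exchange property

-- Since `x ∉ F i`, the intersection `F i ∩ F k` lies in `F k - x`, a codimension-one face of `F k`
-- shared with the earlier `F j`.
Exchange : ∀ {N} → Pred (Fin N) 0ℓ → (Fin N → Subset n) → Fin N → Fin N → Set
Exchange P F i k =
  ∃[ j ] (P j × j Fin.< k × ∃[ x ] (x ∈ F k × x ∉ F i × F k - x ⊆ F j))

-- A shelling in exchange form.  The facets carry the indices satisfying P, so
-- that orders may be built on a convenient index set with unused entries.
record Ordering (K : SimplicialComplex n) : Set₁ where
  field
    N          : ℕ
    F          : Fin N → Subset n
    P          : Pred (Fin N) 0ℓ
    P?         : Decidable P
    facet      : ∀ {i} → P i → Facet K (F i)
    distinct   : ∀ {i j} → P i → P j → F i ≡ F j → i ≡ j
    exhaustive : ∀ σ → Facet K σ → ∃[ i ] (P i × F i ≡ σ)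
    exchange   : ∀ {i k} → P i → P k → i Fin.< k → Exchange P F i k

module _ {K : SimplicialComplex n} (S : Shelling K) where
  open Shelling S

  private
    earlier : Fin t → SimplicialComplex n
    earlier k = before F k ∩ᶜ ⟨ F k ⟩

    earlier? : ∀ k → Decidable (Face (earlier k))
    earlier? k σ =
      map′ {A = ∃[ i ] (i Fin.< k × σ ⊆ F i)} {B = Face (before F k) σ}
           (λ { (i , i<k , σ⊆) → (i , i<k) , σ⊆ }) (λ { ((i , i<k) , σ⊆) → i , i<k , σ⊆ })
           (Fin.any? λ i → (i Fin.<? k) ×-dec (σ ⊆? F i))
      ×-dec (σ ⊆? F k)

  -- Extend `F i ∩ F k` to a facet `ρ` of the part of `⟨ F k ⟩` met by earlier facets. Purity and
  -- codimension make `ρ` only one element smaller than `F k`, so `ρ` is `F k - x` for the missing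
  -- `x`.
  shelling-exchange : ∀ {i k} → i Fin.< k → Exchange (λ _ → ⊤) F i k
  shelling-exchange {i} {k} i<k
    with extend-maximal (earlier? k)
           {F i ∩ F k} (((i , i<k) , proj₁ ∘ x∈p∩q⁻ (F i) (F k)) , proj₂ ∘ x∈p∩q⁻ (F i) (F k))
  ... | ρ , Fi∩Fk⊆ρ , ρ-facet@((((j , j<k) , ρ⊆Fj) , ρ⊆Fk) , _)
    with Fin.any? (λ x → (x ∈? F k) ×-dec ¬? (x ∈? ρ))
  -- Here `F k ⊆ ρ ⊆ F j`, so maximality forces `F k ≡ F j`, against distinctness.
  ... | no ∄ = contradiction
    (distinct (sym (proj₂ (facet k) (F j) (proj₁ (facet j))
      λ {x} x∈Fk → ρ⊆Fj (decidable-stable (x ∈? ρ) λ x∉ρ → ∄ (x , x∈Fk , x∉ρ)))))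
    (Fin.<⇒≢ j<k)
  ... | yes (x , x∈Fk , x∉ρ) =
    j , tt , j<k , x , x∈Fk , (λ x∈Fi → x∉ρ (Fi∩Fk⊆ρ (x∈p∩q⁺ (x∈Fi , x∈Fk)))) ,
    subst (_⊆ F j) (⊆∧∣∣≥⇒≡ (∉-⊆⇒⊆- x∉ρ ρ⊆Fk) ∣Fk-x∣≤∣ρ∣) ρ⊆Fj
    where
    0<k : 0 ℕ.< toℕ k
    0<k = ℕ.≤-<-trans z≤n i<k

    ∣Fk-x∣≤∣ρ∣ : ∣ F k - x ∣ ℕ.≤ ∣ ρ ∣
    -- Some face `σ₀` attains the prescribed dimension, hence has the size of `F k - x`; a facet
    -- above it has the size of `ρ` by purity.
    ∣Fk-x∣≤∣ρ∣ with codimension k 0<k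
    ... | (σ₀ , σ₀-face , dim≡) , _ with extend-maximal (earlier? k) σ₀-face
    ... | σ₁ , σ₀⊆σ₁ , σ₁-facet = begin
      ∣ F k - x ∣ ≡⟨ sym ∣σ₀∣≡ ⟩
      ∣ σ₀ ∣      ≤⟨ p⊆q⇒∣p∣≤∣q∣ σ₀⊆σ₁ ⟩
      ∣ σ₁ ∣      ≡⟨ pure k 0<k σ₁ ρ σ₁-facet ρ-facet ⟩
      ∣ ρ ∣       ∎
      where
      open ℕ.≤-Reasoning
      ∣σ₀∣≡ : ∣ σ₀ ∣ ≡ ∣ F k - x ∣
      ∣σ₀∣≡ = ℤ.+-injective (∙-cancelʳ (ℤ.- 1ℤ) _ _
        (trans dim≡ (cong (λ c → + c ℤ.- 1ℤ ℤ.- 1ℤ) (∣p∣≡1+∣p-x∣ x∈Fk))))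

compress : ∀ {N} {P : Pred (Fin N) 0ℓ} → Decidable P →
           ∃[ t ] ∃ λ (e : Fin t → Fin N) → (∀ i → P (e i)) ×
             (∀ {i j} → i Fin.< j → e i Fin.< e j) × (∀ k → P k → ∃[ i ] e i ≡ k)
compress {zero}  P? = 0 , (λ ()) , (λ ()) , (λ { {()} }) , λ ()
compress {suc N} P? with compress (P? ∘ suc) | P? zero
... | t , e , Pe , mono , onto | yes p = suc t
  , (λ { zero → zero ; (suc i) → suc (e i) })
  , (λ { zero → p ; (suc i) → Pe i })
  , (λ { {zero} {suc j} _ → s≤s z≤n ; {suc i} {suc j} (s≤s i<j) → s≤s (mono i<j) })
  , (λ { zero _ → zero , refl ; (suc k) q → let i , eq = onto k q in suc i , cong suc eq })
... | t , e , Pe , mono , onto | no ¬p = t , suc ∘ e , Pe , s≤s ∘ mono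
  , (λ { zero p → contradiction p ¬p ; (suc k) q → let i , eq = onto k q in i , cong suc eq })

module _ {K : SimplicialComplex n} (O : Ordering K) where
  private
    open module O = Ordering O hiding (F)

    t = proj₁ (compress P?)
    e = proj₁ (proj₂ (compress P?))
    Pe = proj₁ (proj₂ (proj₂ (compress P?)))
    e-mono = proj₁ (proj₂ (proj₂ (proj₂ (compress P?))))
    e-onto = proj₂ (proj₂ (proj₂ (proj₂ (compress P?))))

    e-injective : Injective _≡_ _≡_ e
    e-injective {i} {j} ei≡ej with Fin.<-cmp i j
    ... | tri< i<j _ _ = contradiction ei≡ej (Fin.<⇒≢ (e-mono i<j))
    ... | tri≈ _ i≡j _ = i≡j
    ... | tri> _ _ j<i = contradiction (sym ei≡ej) (Fin.<⇒≢ (e-mono j<i))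

    e-reflects-< : ∀ {i j} → e i Fin.< e j → i Fin.< j
    e-reflects-< {i} {j} ei<ej with Fin.<-cmp i j
    ... | tri< i<j _ _ = i<j
    ... | tri≈ _ i≡j _ = contradiction (cong e i≡j) (Fin.<⇒≢ ei<ej)
    ... | tri> _ _ j<i = contradiction ei<ej (Fin.<-asym (e-mono j<i))

    F : Fin t → Subset n
    F = O.F ∘ e

    exch : ∀ {i k} → i Fin.< k → Exchange (λ _ → ⊤) F i k
    exch {i} {k} i<k with exchange (Pe i) (Pe k) (e-mono i<k)
    ... | j , Pj , j<k , rest with e-onto j Pj
    ... | j′ , refl = j′ , tt , e-reflects-< j<k , rest

    first : ∀ {N} (k : Fin N) → 0 ℕ.< toℕ k → ∃ λ (i : Fin N) → i Fin.< k
    first (suc k) _ = zero , s≤s z≤n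

    -- The exchange vertex `x` avoids `F i`, hence `σ`. Every face thus lies in a face of size one
    -- less than `F k`, which yields both purity and the dimension.
    ridge : ∀ {i k σ} → i Fin.< k → σ ⊆ F i → σ ⊆ F k →
            ∃[ x ] (x ∈ F k × Face (before F k ∩ᶜ ⟨ F k ⟩) (F k - x) × σ ⊆ F k - x)
    ridge {k = k} i<k σ⊆Fi σ⊆Fk with exch i<k
    ... | j , _ , j<k , x , x∈Fk , x∉Fi , Fk-x⊆Fj =
      x , x∈Fk , (((j , j<k) , Fk-x⊆Fj) , p─q⊆p (F k) ⁅ x ⁆) , ∉-⊆⇒⊆- (x∉Fi ∘ σ⊆Fi) σ⊆Fk

    facet-size : ∀ {k σ} → Facet (before F k ∩ᶜ ⟨ F k ⟩) σ → suc ∣ σ ∣ ≡ ∣ F k ∣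
    facet-size {k} ((((i , i<k) , σ⊆Fi) , σ⊆Fk) , max) with ridge i<k σ⊆Fi σ⊆Fk
    ... | x , x∈Fk , face , σ⊆ =
      trans (cong (suc ∘ ∣_∣) (max _ face σ⊆)) (sym (∣p∣≡1+∣p-x∣ x∈Fk))

    dim-ridge : ∀ {k x} → x ∈ F k → dim (F k) ℤ.- 1ℤ ≡ dim (F k - x)
    dim-ridge x∈Fk = cong (λ c → + c ℤ.- 1ℤ ℤ.- 1ℤ) (∣p∣≡1+∣p-x∣ x∈Fk)

    codim : ∀ k → 0 ℕ.< toℕ k → HasDimension (before F k ∩ᶜ ⟨ F k ⟩) (dim (F k) ℤ.- 1ℤ)
    codim k 0<k = nonempty , bounded
      where
      nonempty : ∃[ σ ] (Face (before F k ∩ᶜ ⟨ F k ⟩) σ × dim σ ≡ dim (F k) ℤ.- 1ℤ)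
      nonempty with first k 0<k
      ... | i , i<k with exch i<k
      ... | j , _ , j<k , x , x∈Fk , _ , ⊆Fj =
        F k - x , (((j , j<k) , ⊆Fj) , p─q⊆p (F k) ⁅ x ⁆) , sym (dim-ridge x∈Fk)

      bounded : ∀ σ → Face (before F k ∩ᶜ ⟨ F k ⟩) σ → dim σ ℤ.≤ dim (F k) ℤ.- 1ℤ
      bounded σ (((i , i<k) , σ⊆Fi) , σ⊆Fk) with ridge i<k σ⊆Fi σ⊆Fk
      ... | x , x∈Fk , _ , σ⊆ = subst (dim σ ℤ.≤_) (sym (dim-ridge x∈Fk))
        (ℤ.+-monoˡ-≤ (ℤ.- 1ℤ) (ℤ.+≤+ (p⊆q⇒∣p∣≤∣q∣ σ⊆)))

  ordering⇒shelling : Shelling K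
  ordering⇒shelling = record
    { t           = t
    ; F           = F
    ; facet       = λ i → facet (Pe i)
    ; distinct    = λ {i} {j} → e-injective ∘ distinct (Pe i) (Pe j)
    ; exhaustive  = λ σ f → let i , Pi , Fi≡σ = exhaustive σ f
                                i′ , ei′≡i = e-onto i Pi
                            in i′ , trans (cong O.F ei′≡i) Fi≡σ
    ; pure        = λ k _ σ τ f g → ℕ.suc-injective (trans (facet-size f) (sym (facet-size g)))
    ; codimension = codim
    }

-- Maximal independent sets as independent dominating sets

-- A form of maximality that can be checked one vertex at a time, with an explicit neighbour as
-- witness.
Kernel : Graph n → Pred (Subset n) 0ℓ
Kernel G σ = Independent G σ × (∀ x → x ∉ σ → ∃[ y ] (y ∈ σ × Adj G x y))

module _ (G : Graph n) where
  open Graph G using (adj?; symm; irrefl)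

  independent? : Decidable (Independent G)
  independent? σ = map′ (λ ind {u} {v} → ind u v) (λ ind u v → ind {u} {v})
    (Fin.all? λ u → Fin.all? λ v → (u ∈? σ) →-dec ((v ∈? σ) →-dec ¬? (adj? u v)))

  kernel⇒maximal : ∀ {σ} → Kernel G σ → MaximalIndependent G σ
  kernel⇒maximal {σ} (ind , dom) = ind , λ τ τ-ind σ⊆τ →
    ⊆-antisym σ⊆τ λ {x} x∈τ → decidable-stable (x ∈? σ) λ x∉σ →
      let y , y∈σ , x~y = dom x x∉σ in τ-ind x∈τ (σ⊆τ y∈σ) x~y

  -- If `x` had no neighbour in `σ`, then `σ ∪ ⁅ x ⁆` would be a larger independent set; decidable
  -- adjacency turns this into a witness.
  maximal⇒kernel : ∀ {σ} → MaximalIndependent G σ → Kernel G σ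
  maximal⇒kernel {σ} (ind , max) = ind , dom
    where
    dom : ∀ x → x ∉ σ → ∃[ y ] (y ∈ σ × Adj G x y)
    dom x x∉σ with Fin.any? (λ y → (y ∈? σ) ×-dec adj? x y)
    ... | yes p = p
    ... | no ∄ = contradiction
      (subst (x ∈_) (sym (max (σ ∪ ⁅ x ⁆) ind′ (p⊆p∪q ⁅ x ⁆))) (x∈p∪q⁺ (inj₂ (x∈⁅x⁆ x)))) x∉σ
      where
      ind′ : Independent G (σ ∪ ⁅ x ⁆)
      ind′ u∈ v∈ u~v with x∈p∪q⁻ σ ⁅ x ⁆ u∈ | x∈p∪q⁻ σ ⁅ x ⁆ v∈
      ... | inj₁ u∈σ | inj₁ v∈σ = ind u∈σ v∈σ u~v
      ... | inj₁ u∈σ | inj₂ v∈x with refl ← x∈⁅y⁆⇒x≡y x v∈x = ∄ (_ , u∈σ , symm u~v)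
      ... | inj₂ u∈x | inj₁ v∈σ with refl ← x∈⁅y⁆⇒x≡y x u∈x = ∄ (_ , v∈σ , u~v)
      ... | inj₂ u∈x | inj₂ v∈x =
        irrefl (trans (x∈⁅y⁆⇒x≡y x u∈x) (sym (x∈⁅y⁆⇒x≡y x v∈x))) u~v

-- Deleting and reinserting the vertex `v₀`

module _ (v₀ : Fin (suc n)) where

  punchView : ∀ v → v ≡ v₀ ⊎ (∃[ j ] punchIn v₀ j ≡ v)
  punchView v with v₀ Fin.≟ v
  ... | yes v₀≡v = inj₁ (sym v₀≡v)
  ... | no v₀≢v = inj₂ (punchOut v₀≢v , Fin.punchIn-punchOut v₀≢v)

  delete : Subset (suc n) → Subset n
  delete = preimage (punchIn v₀)

  v₀∈insert : ∀ τ → v₀ ∈ insertAt τ v₀ inside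
  v₀∈insert τ = lookup⇒[]= v₀ _ (insertAt-lookup τ v₀ inside)

  v₀∉insert : ∀ τ → v₀ ∉ insertAt τ v₀ outside
  v₀∉insert τ v₀∈ with () ← trans (sym ([]=⇒lookup v₀∈)) (insertAt-lookup τ v₀ outside)

  module _ (τ : Subset n) (s : Side) where

    ∈-insert⁺ : ∀ {j} → j ∈ τ → punchIn v₀ j ∈ insertAt τ v₀ s
    ∈-insert⁺ {j} j∈τ = lookup⇒[]= _ _ (trans (insertAt-punchIn τ v₀ s j) ([]=⇒lookup j∈τ))

    ∈-insert⁻ : ∀ {j} → punchIn v₀ j ∈ insertAt τ v₀ s → j ∈ τ
    ∈-insert⁻ {j} j∈ = lookup⇒[]= j τ (trans (sym (insertAt-punchIn τ v₀ s j)) ([]=⇒lookup j∈))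

    delete-insert : delete (insertAt τ v₀ s) ≡ τ
    delete-insert = ⊆-antisym (∈-insert⁻ ∘ ∈-preimage⁻ (punchIn v₀) (insertAt τ v₀ s))
                              (∈-preimage⁺ (punchIn v₀) (insertAt τ v₀ s) ∘ ∈-insert⁺)

module _ (H : Graph (suc n)) (v₀ : Fin (suc n)) where

  -- The neighbour condition of (2): `v₀` is a shedding vertex, so that maximal independent sets of
  -- `H ∖ v₀` stay maximal in `H`.
  Guarded : Set
  Guarded = ∀ τ → MaximalIndependent (H ∖ v₀) τ → ∃[ v ] (v ∈ τ × Adj H v₀ (punchIn v₀ v))

  -- Domination is asked only away from `v₀`, so that this applies to slices of a glued graph, where
  -- `v₀` may be dominated from another copy.
  delete-kernel : ∀ {σ} → Independent H σ → v₀ ∉ σ →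
                  (∀ v → v ≢ v₀ → v ∉ σ → ∃[ w ] (w ∈ σ × Adj H v w)) →
                  Kernel (H ∖ v₀) (delete v₀ σ)
  delete-kernel {σ} ind v₀∉σ dom =
    (λ u∈ v∈ → ind (∈-preimage⁻ _ σ u∈) (∈-preimage⁻ _ σ v∈)) , dom′
    where
    dom′ : ∀ x → x ∉ delete v₀ σ →
           ∃[ y ] (y ∈ delete v₀ σ × Adj H (punchIn v₀ x) (punchIn v₀ y))
    dom′ x x∉ with dom (punchIn v₀ x) (Fin.punchInᵢ≢i v₀ x) (x∉ ∘ ∈-preimage⁺ _ σ)
    ... | w , w∈σ , x~w with punchView v₀ w
    ... | inj₁ refl = contradiction w∈σ v₀∉σ
    ... | inj₂ (y , refl) = y , ∈-preimage⁺ _ σ w∈σ , x~w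

  insert-outside-independent : ∀ {τ} → Independent (H ∖ v₀) τ →
                               Independent H (insertAt τ v₀ outside)
  insert-outside-independent {τ} ind {u} {v} u∈ v∈ u~v with punchView v₀ u | punchView v₀ v
  ... | inj₁ refl | _ = v₀∉insert v₀ τ u∈
  ... | inj₂ _ | inj₁ refl = v₀∉insert v₀ τ v∈
  ... | inj₂ (i , refl) | inj₂ (j , refl) =
    ind (∈-insert⁻ v₀ τ outside u∈) (∈-insert⁻ v₀ τ outside v∈) u~v

  insert-inside-independent : ∀ {τ} → Independent (H ∖ v₀) τ →
                              (∀ {v} → v ∈ τ → ¬ Adj H v₀ (punchIn v₀ v)) →
                              Independent H (insertAt τ v₀ inside)
  insert-inside-independent {τ} ind free {u} {v} u∈ v∈ u~v with punchView v₀ u | punchView v₀ v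
  ... | inj₁ refl | inj₁ refl = Graph.irrefl H refl u~v
  ... | inj₁ refl | inj₂ (j , refl) = free (∈-insert⁻ v₀ τ inside v∈) u~v
  ... | inj₂ (i , refl) | inj₁ refl = free (∈-insert⁻ v₀ τ inside u∈) (Graph.symm H u~v)
  ... | inj₂ (i , refl) | inj₂ (j , refl) =
    ind (∈-insert⁻ v₀ τ inside u∈) (∈-insert⁻ v₀ τ inside v∈) u~v

  insert-dominates : ∀ {τ s} → Kernel (H ∖ v₀) τ → ∀ v → v ≢ v₀ → v ∉ insertAt τ v₀ s →
                     ∃[ w ] (w ∈ insertAt τ v₀ s × Adj H v w)
  insert-dominates {τ} {s} (_ , dom) v v≢v₀ v∉ with punchView v₀ v
  ... | inj₁ v≡v₀ = contradiction v≡v₀ v≢v₀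
  ... | inj₂ (j , refl) with dom j (v∉ ∘ ∈-insert⁺ v₀ τ s)
  ... | y , y∈τ , j~y = punchIn v₀ y , ∈-insert⁺ v₀ τ s y∈τ , j~y

  -- The neighbour condition dominates `v₀`; any other vertex left out is dominated within `τ`.
  insert-kernel : Guarded → ∀ {τ} → Kernel (H ∖ v₀) τ → Kernel H (insertAt τ v₀ outside)
  insert-kernel guarded {τ} ker = insert-outside-independent (proj₁ ker) , dom
    where
    dom : ∀ v → v ∉ insertAt τ v₀ outside → ∃[ w ] (w ∈ insertAt τ v₀ outside × Adj H v w)
    dom v v∉ with v Fin.≟ v₀
    ... | no v≢v₀ = insert-dominates ker v v≢v₀ v∉
    ... | yes refl with guarded τ (kernel⇒maximal (H ∖ v₀) ker)
    ... | w , w∈τ , v₀~w = punchIn v₀ w , ∈-insert⁺ v₀ τ outside w∈τ , v₀~w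

-- Independent sets of the glued graph as families of slices

slice : Subset (m * n) → Fin m → Subset n
slice σ u = preimage (combine u) σ

-- Concatenation places entry `v` of row `u` at `combine u v`, and cardinalities add up along the
-- rows.
glue : (Fin m → Subset n) → Subset (m * n)
glue f = concat (tabulate f)

module _ (f : Fin m → Subset n) where

  lookup-glue : ∀ u v → lookup (glue f) (combine u v) ≡ lookup (f u) v
  lookup-glue u v = trans (lookup-concat (tabulate f) u v)
                          (cong (λ σ → lookup σ v) (lookup∘tabulate f u))

  ∈-glue⁺ : ∀ {u v} → v ∈ f u → combine u v ∈ glue f
  ∈-glue⁺ {u} {v} v∈ = lookup⇒[]= _ _ (trans (lookup-glue u v) ([]=⇒lookup v∈))

  ∈-glue⁻ : ∀ {u v} → combine u v ∈ glue f → v ∈ f u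
  ∈-glue⁻ {u} {v} p = lookup⇒[]= v (f u) (trans (sym (lookup-glue u v)) ([]=⇒lookup p))

  slice-glue : ∀ u → slice (glue f) u ≡ f u
  slice-glue u = ⊆-antisym (∈-glue⁻ ∘ ∈-preimage⁻ (combine u) (glue f))
                           (∈-preimage⁺ (combine u) (glue f) ∘ ∈-glue⁺)

glue-cong : {f g : Fin m → Subset n} → (∀ u → f u ≡ g u) → glue f ≡ glue g
glue-cong = cong concat ∘ tabulate-cong

glue-slice : (σ : Subset (m * n)) → glue (slice {m} {n} σ) ≡ σ
glue-slice {m} {n} σ = ⊆-antisym to from
  where
  to : glue (slice {m} {n} σ) ⊆ σ
  to {x} x∈ with u , v , refl ← Fin.combine-surjective {m} {n} x =
    ∈-preimage⁻ (combine u) σ (∈-glue⁻ (slice {m} {n} σ) x∈)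
  from : σ ⊆ glue (slice {m} {n} σ)
  from {x} x∈ with u , v , refl ← Fin.combine-surjective {m} {n} x =
    ∈-glue⁺ (slice {m} {n} σ) (∈-preimage⁺ (combine u) σ x∈)

∣++∣ : (p : Subset m) (q : Subset n) → ∣ p Vec.++ q ∣ ≡ ∣ p ∣ + ∣ q ∣
∣++∣ []            q = refl
∣++∣ (inside ∷ p)  q = cong suc (∣++∣ p q)
∣++∣ (outside ∷ p) q = ∣++∣ p q

∣glue∣ : (f : Fin (suc m) → Subset n) → ∣ glue f ∣ ≡ ∣ f zero ∣ + ∣ glue (f ∘ suc) ∣
∣glue∣ f = ∣++∣ (f zero) (glue (f ∘ suc))

∣glue∣-cong : (f g : Fin m → Subset n) → (∀ u → ∣ f u ∣ ≡ ∣ g u ∣) → ∣ glue f ∣ ≡ ∣ glue g ∣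
∣glue∣-cong {zero}  f g eq = refl
∣glue∣-cong {suc m} f g eq = trans (∣glue∣ f)
  (trans (cong₂ _+_ (eq zero) (∣glue∣-cong (f ∘ suc) (g ∘ suc) (eq ∘ suc))) (sym (∣glue∣ g)))

module _ (G : Graph m) (H : Graph (suc n)) (v₀ : Fin (suc n)) where
  private GH = G [ H ⨾ v₀ ]

  Compatible : (Fin m → Subset (suc n)) → Set
  Compatible f = ∀ u u′ → Adj G u u′ → v₀ ∈ f u → v₀ ∉ f u′

  compatible? : Decidable Compatible
  compatible? f = Fin.all? λ u → Fin.all? λ u′ →
    Graph.adj? G u u′ →-dec ((v₀ ∈? f u) →-dec ¬? (v₀ ∈? f u′))

  -- Only a copy of `v₀` can have neighbours outside its own copy of `H`.
  Dominated : (Fin m → Subset (suc n)) → Fin m → Fin (suc n) → Set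
  Dominated f u v = (∃[ w ] (w ∈ f u × Adj H v w)) ⊎ (v ≡ v₀ × ∃[ u′ ] (v₀ ∈ f u′ × Adj G u u′))

  adj⁺ : ∀ u v u′ v′ → GluedAdj G H v₀ (u , v) (u′ , v′) → Adj GH (combine u v) (combine u′ v′)
  adj⁺ u v u′ v′ = subst₂ (GluedAdj G H v₀) (sym (Fin.remQuot-combine u v)) (sym (Fin.remQuot-combine u′ v′))

  adj⁻ : ∀ u v u′ v′ → Adj GH (combine u v) (combine u′ v′) → GluedAdj G H v₀ (u , v) (u′ , v′)
  adj⁻ u v u′ v′ = subst₂ (GluedAdj G H v₀) (Fin.remQuot-combine u v) (Fin.remQuot-combine u′ v′)

  glue-kernel : ∀ {f} → (∀ u → Independent H (f u)) → Compatible f →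
                (∀ u v → v ∉ f u → Dominated f u v) → Kernel GH (glue f)
  glue-kernel {f} ind com dom = ind′ , dom′
    where
    ind′ : Independent GH (glue f)
    ind′ {x} {y} x∈ y∈ x~y
      with u , v , refl ← Fin.combine-surjective {m} {suc n} x
         | u′ , v′ , refl ← Fin.combine-surjective {m} {suc n} y
      with adj⁻ u v u′ v′ x~y
    ... | inj₁ (refl , v~v′) = ind u (∈-glue⁻ f x∈) (∈-glue⁻ f y∈) v~v′
    ... | inj₂ (u~u′ , refl , refl) = com u u′ u~u′ (∈-glue⁻ f x∈) (∈-glue⁻ f y∈)

    dom′ : ∀ x → x ∉ glue f → ∃[ y ] (y ∈ glue f × Adj GH x y)
    dom′ x x∉ with u , v , refl ← Fin.combine-surjective {m} {suc n} x
      with dom u v (x∉ ∘ ∈-glue⁺ f)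
    ... | inj₁ (w , w∈ , v~w) = combine u w , ∈-glue⁺ f w∈ , adj⁺ u v u w (inj₁ (refl , v~w))
    ... | inj₂ (refl , u′ , v₀∈ , u~u′) =
      combine u′ v₀ , ∈-glue⁺ f v₀∈ , adj⁺ u v₀ u′ v₀ (inj₂ (u~u′ , refl , refl))

  module _ {σ} (ker : Kernel GH σ) where

    slice-independent : ∀ u → Independent H (slice σ u)
    slice-independent u {v} {w} v∈ w∈ v~w = proj₁ ker
      (∈-preimage⁻ (combine u) σ v∈) (∈-preimage⁻ (combine u) σ w∈) (adj⁺ u v u w (inj₁ (refl , v~w)))

    slice-compatible : Compatible (slice σ)
    slice-compatible u u′ u~u′ v₀∈u v₀∈u′ = proj₁ ker
      (∈-preimage⁻ (combine u) σ v₀∈u) (∈-preimage⁻ (combine u′) σ v₀∈u′)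
      (adj⁺ u v₀ u′ v₀ (inj₂ (u~u′ , refl , refl)))

    slice-dominated : ∀ u v → v ∉ slice σ u → Dominated (slice σ) u v
    slice-dominated u v v∉ with proj₂ ker (combine u v) (v∉ ∘ ∈-preimage⁺ (combine u) σ)
    ... | y , y∈ , x~y with u′ , w , refl ← Fin.combine-surjective {m} {suc n} y
      with adj⁻ u v u′ w x~y
    ... | inj₁ (refl , v~w) = inj₁ (w , ∈-preimage⁺ (combine u) σ y∈ , v~w)
    ... | inj₂ (u~u′ , v≡v₀ , refl) = inj₂ (v≡v₀ , u′ , ∈-preimage⁺ (combine u′) σ y∈ , u~u′)

    -- If `v₀` is missing from a slice, all other vertices are dominated inside that copy, so the
    -- slice is maximal in `H ∖ v₀`. The neighbour condition then dominates `v₀` inside the copy as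
    -- well.
    slice-kernel : Guarded H v₀ → ∀ u → Kernel H (slice σ u)
    slice-kernel guarded u = slice-independent u , dom
      where
      inner : ∀ v → v ≢ v₀ → v ∉ slice σ u → ∃[ w ] (w ∈ slice σ u × Adj H v w)
      inner v v≢v₀ v∉ with slice-dominated u v v∉
      ... | inj₁ p = p
      ... | inj₂ (v≡v₀ , _) = contradiction v≡v₀ v≢v₀

      dom : ∀ v → v ∉ slice σ u → ∃[ w ] (w ∈ slice σ u × Adj H v w)
      dom v v∉ with v Fin.≟ v₀
      ... | no v≢v₀ = inner v v≢v₀ v∉
      ... | yes refl with guarded (delete v₀ (slice σ u))
                       (kernel⇒maximal (H ∖ v₀) (delete-kernel H v₀ (slice-independent u) v∉ inner))
      ... | w , w∈ , v₀~w = punchIn v₀ w , ∈-preimage⁻ (punchIn v₀) (slice σ u) w∈ , v₀~w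

  glue-facet : ∀ {f} → (∀ u → MaximalIndependent H (f u)) → Compatible f →
               MaximalIndependent GH (glue f)
  glue-facet max com = kernel⇒maximal GH (glue-kernel (proj₁ ∘ max) com
    λ u v v∉ → inj₁ (proj₂ (maximal⇒kernel H (max u)) v v∉))

  slice-facet : Guarded H v₀ → ∀ {σ} → MaximalIndependent GH σ → ∀ u → MaximalIndependent H (slice σ u)
  slice-facet guarded max u = kernel⇒maximal H (slice-kernel (maximal⇒kernel GH max) guarded u)

-- Shellings of links

-- The facets of K containing ρ, in the order of a shelling of K, shell the link of ρ.
module _ {K : SimplicialComplex n} {L : SimplicialComplex m} (S : Shelling K)
         (e : Fin m → Fin n) (e-injective : Injective _≡_ _≡_ e) (ρ : Subset n)
         (cover  : ∀ {F} → Facet K F → ρ ⊆ F → ∀ {x} → x ∈ F → x ∈ ρ ⊎ (∃[ v ] e v ≡ x))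
         (facet⁺ : ∀ {F} → Facet K F → ρ ⊆ F → Facet L (preimage e F))
         (facet⁻ : ∀ {σ} → Facet L σ → ∃[ F ] (Facet K F × ρ ⊆ F × preimage e F ≡ σ))
         where
  private
    open module S = Shelling S using (F)

    -- By `cover`, a facet containing `ρ` is determined by its part along `e`.
    preimage-reflects-⊆ : ∀ {i j} → ρ ⊆ F i → ρ ⊆ F j →
                          preimage e (F i) ⊆ preimage e (F j) → F i ⊆ F j
    preimage-reflects-⊆ {i} {j} ρ⊆Fi ρ⊆Fj pre {x} x∈ with cover (S.facet i) ρ⊆Fi x∈
    ... | inj₁ x∈ρ = ρ⊆Fj x∈ρ
    ... | inj₂ (v , refl) = ∈-preimage⁻ e (F j) (pre (∈-preimage⁺ e (F i) x∈))

    exch : ∀ {i k} → ρ ⊆ F i → ρ ⊆ F k → i Fin.< k →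
           Exchange (λ j → ρ ⊆ F j) (preimage e ∘ F) i k
    exch {i} {k} ρ⊆Fi ρ⊆Fk i<k with shelling-exchange S i<k
    ... | j , _ , j<k , x , x∈Fk , x∉Fi , Fk-x⊆Fj with cover (S.facet k) ρ⊆Fk x∈Fk
    -- As `ρ ⊆ F i` and `x ∉ F i`, the removed vertex lies outside `ρ`; this also keeps `ρ` inside
    -- `F j`.
    ... | inj₁ x∈ρ = contradiction (ρ⊆Fi x∈ρ) x∉Fi
    ... | inj₂ (v , refl) =
      j , Fk-x⊆Fj ∘ ∉-⊆⇒⊆- (x∉Fi ∘ ρ⊆Fi) ρ⊆Fk , j<k ,
      v , ∈-preimage⁺ e (F k) x∈Fk , x∉Fi ∘ ∈-preimage⁻ e (F i) ,
      p-x⊆q v λ w∈ w≢v → ∈-preimage⁺ e (F j)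
        (Fk-x⊆Fj (x∈p∧x≢y⇒x∈p-y (∈-preimage⁻ e (F k) w∈) (w≢v ∘ e-injective)))

  link-ordering : Ordering L
  link-ordering = record
    { N          = S.t
    ; F          = preimage e ∘ F
    ; P          = λ i → ρ ⊆ F i
    ; P?         = λ i → ρ ⊆? F i
    ; facet      = λ {i} ρ⊆Fi → facet⁺ (S.facet i) ρ⊆Fi
    ; distinct   = λ ρ⊆Fi ρ⊆Fj eq → S.distinct (⊆-antisym
        (preimage-reflects-⊆ ρ⊆Fi ρ⊆Fj (⊆-reflexive eq))
        (preimage-reflects-⊆ ρ⊆Fj ρ⊆Fi (⊆-reflexive (sym eq))))
    ; exhaustive = exh
    ; exchange   = exch
    }
    where
    exh : ∀ σ → Facet L σ → ∃[ i ] (ρ ⊆ F i × preimage e (F i) ≡ σ)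
    exh σ σ-facet with facet⁻ σ-facet
    ... | F′ , F′-facet , ρ⊆F′ , eq with S.exhaustive F′ F′-facet
    ... | i , refl = i , ρ⊆F′ , eq

-- Concatenated orders and the facets avoiding `v₀` first

module _ {a h : ℕ} where
  infix 4 _≺_

  -- The order of two concatenated blocks, as a data type so that the relative position of two
  -- indices can be matched on.
  data _≺_ : Fin a ⊎ Fin h → Fin a ⊎ Fin h → Set where
    left  : ∀ {i j} → i Fin.< j → inj₁ i ≺ inj₁ j
    cross : ∀ {i j} → inj₁ i ≺ inj₂ j
    right : ∀ {i j} → i Fin.< j → inj₂ i ≺ inj₂ j

  join-mono : ∀ {x y} → x ≺ y → join a h x Fin.< join a h y
  join-mono {inj₁ i} {inj₁ j} (left i<j) =
    subst₂ ℕ._<_ (sym (Fin.toℕ-↑ˡ i h)) (sym (Fin.toℕ-↑ˡ j h)) i<j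
  join-mono {inj₁ i} {inj₂ j} cross =
    subst₂ ℕ._<_ (sym (Fin.toℕ-↑ˡ i h)) (sym (Fin.toℕ-↑ʳ a j))
      (ℕ.<-≤-trans (Fin.toℕ<n i) (ℕ.m≤m+n a (toℕ j)))
  join-mono {inj₂ i} {inj₂ j} (right i<j) =
    subst₂ ℕ._<_ (sym (Fin.toℕ-↑ʳ a i)) (sym (Fin.toℕ-↑ʳ a j)) (ℕ.+-monoʳ-< a i<j)

  ≺-compare : ∀ x y → x ≺ y ⊎ x ≡ y ⊎ y ≺ x
  ≺-compare (inj₁ i) (inj₁ j) with Fin.<-cmp i j
  ... | tri< i<j _ _ = inj₁ (left i<j)
  ... | tri≈ _ refl _ = inj₂ (inj₁ refl)
  ... | tri> _ _ j<i = inj₂ (inj₂ (left j<i))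
  ≺-compare (inj₁ i) (inj₂ j) = inj₁ cross
  ≺-compare (inj₂ i) (inj₁ j) = inj₂ (inj₂ cross)
  ≺-compare (inj₂ i) (inj₂ j) with Fin.<-cmp i j
  ... | tri< i<j _ _ = inj₁ (right i<j)
  ... | tri≈ _ refl _ = inj₂ (inj₁ refl)
  ... | tri> _ _ j<i = inj₂ (inj₂ (right j<i))

  -- The inverse of a monotone bijection between total orders is monotone.
  splitAt-mono : ∀ {i j : Fin (a + h)} → i Fin.< j → splitAt a i ≺ splitAt a j
  splitAt-mono {i} {j} i<j with ≺-compare (splitAt a i) (splitAt a j)
  ... | inj₁ lt = lt
  ... | inj₂ (inj₁ eq) = contradiction
    (trans (sym (Fin.join-splitAt a h i)) (trans (cong (join a h) eq) (Fin.join-splitAt a h j)))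
    (Fin.<⇒≢ i<j)
  ... | inj₂ (inj₂ gt) = contradiction
    (subst₂ Fin._<_ (Fin.join-splitAt a h j) (Fin.join-splitAt a h i) (join-mono gt))
    (Fin.<-asym i<j)

-- Read backwards, moving to an earlier facet never introduces `v`.
Sorted : {K : SimplicialComplex n} → Ordering K → Fin n → Set
Sorted O v = ∀ {i k} → P i → P k → i Fin.< k → v ∈ F i → v ∈ F k
  where open Ordering O

-- First the facets of H that avoid v₀, shelled as the facets of H ∖ v₀, and
-- then those that contain v₀, shelled as the link of v₀ in H.
module _ (H : Graph (suc n)) (v₀ : Fin (suc n)) (guarded : Guarded H v₀)
         (SH : Shellable H) (SD : Shellable (H ∖ v₀)) where
  private
    module SH = Shelling SH
    module SD = Shelling SD

    Index : Set
    Index = Fin SD.t ⊎ Fin SH.t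

    F : Index → Subset (suc n)
    F = [ (λ i → insertAt (SD.F i) v₀ outside) , SH.F ]′

    -- The second block keeps all indices of the shelling of `H`, but its facets avoiding `v₀`
    -- already occur in the first block.
    P : Pred Index 0ℓ
    P (inj₁ _) = ⊤
    P (inj₂ j) = v₀ ∈ SH.F j

    P? : Decidable P
    P? (inj₁ _) = yes tt
    P? (inj₂ j) = v₀ ∈? SH.F j

    facet : ∀ x → P x → MaximalIndependent H (F x)
    facet (inj₁ i) _ = kernel⇒maximal H
      (insert-kernel H v₀ guarded (maximal⇒kernel (H ∖ v₀) (SD.facet i)))
    facet (inj₂ j) _ = SH.facet j

    distinct : ∀ x y → P x → P y → F x ≡ F y → x ≡ y
    distinct (inj₁ i) (inj₁ j) _ _ eq = cong inj₁ (SD.distinct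
      (trans (sym (delete-insert v₀ _ outside))
        (trans (cong (delete v₀) eq) (delete-insert v₀ _ outside))))
    distinct (inj₁ i) (inj₂ j) _ v₀∈ eq = contradiction (subst (v₀ ∈_) (sym eq) v₀∈) (v₀∉insert v₀ _)
    distinct (inj₂ i) (inj₁ j) v₀∈ _ eq = contradiction (subst (v₀ ∈_) eq v₀∈) (v₀∉insert v₀ _)
    distinct (inj₂ i) (inj₂ j) _ _ eq = cong inj₂ (SH.distinct eq)

    insert-delete : ∀ {σ} → v₀ ∉ σ → insertAt (delete v₀ σ) v₀ outside ≡ σ
    insert-delete {σ} v₀∉σ = ⊆-antisym to from
      where
      to : insertAt (delete v₀ σ) v₀ outside ⊆ σ
      to {x} x∈ with punchView v₀ x
      ... | inj₁ refl = contradiction x∈ (v₀∉insert v₀ _)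
      ... | inj₂ (_ , refl) = ∈-preimage⁻ (punchIn v₀) σ (∈-insert⁻ v₀ _ outside x∈)
      from : σ ⊆ insertAt (delete v₀ σ) v₀ outside
      from {x} x∈ with punchView v₀ x
      ... | inj₁ refl = contradiction x∈ v₀∉σ
      ... | inj₂ (_ , refl) = ∈-insert⁺ v₀ _ outside (∈-preimage⁺ (punchIn v₀) σ x∈)

    exhaustive : ∀ σ → MaximalIndependent H σ → ∃[ x ] (P x × F x ≡ σ)
    exhaustive σ max with v₀ ∈? σ
    ... | yes v₀∈σ with j , refl ← SH.exhaustive σ max = inj₂ j , v₀∈σ , refl
    ... | no v₀∉σ with maximal⇒kernel H max
    ... | ind , dom with SD.exhaustive (delete v₀ σ)
                         (kernel⇒maximal (H ∖ v₀) (delete-kernel H v₀ ind v₀∉σ λ v _ → dom v))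
    ... | i , eq = inj₁ i , tt ,
      trans (cong (λ τ → insertAt τ v₀ outside) eq) (insert-delete v₀∉σ)

    exchange : ∀ {x z} → P x → P z → x ≺ z →
               ∃[ y ] (P y × y ≺ z × ∃[ v ] (v ∈ F z × v ∉ F x × F z - v ⊆ F y))
    exchange {inj₁ i} {inj₁ k} _ _ (left i<k) with shelling-exchange SD i<k
    ... | j , _ , j<k , v , v∈ , v∉ , sub =
      inj₁ j , tt , left j<k , punchIn v₀ v , ∈-insert⁺ v₀ _ outside v∈ ,
      v∉ ∘ ∈-insert⁻ v₀ _ outside , p-x⊆q (punchIn v₀ v) sub′
      where
      sub′ : ∀ {w} → w ∈ F (inj₁ k) → w ≢ punchIn v₀ v → w ∈ F (inj₁ j)
      sub′ {w} w∈ w≢ with punchView v₀ w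
      ... | inj₁ refl = contradiction w∈ (v₀∉insert v₀ _)
      ... | inj₂ (w′ , refl) = ∈-insert⁺ v₀ _ outside
        (sub (x∈p∧x≢y⇒x∈p-y (∈-insert⁻ v₀ _ outside w∈) (w≢ ∘ cong (punchIn v₀))))
    -- The exchanged vertex is `v₀`: what remains of the facet is independent in `H ∖ v₀` and
    -- extends to a facet of the first block.
    exchange {inj₁ i} {inj₂ k} _ v₀∈ cross
      with extend-maximal (independent? (H ∖ v₀)) {delete v₀ (SH.F k)}
             (λ u∈ v∈ → proj₁ (SH.facet k) (∈-preimage⁻ (punchIn v₀) _ u∈) (∈-preimage⁻ (punchIn v₀) _ v∈))
    ... | τ , sub , max with SD.exhaustive τ max
    ... | j , refl = inj₁ j , tt , cross , v₀ , v₀∈ , v₀∉insert v₀ _ , p-x⊆q v₀ sub′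
      where
      sub′ : ∀ {w} → w ∈ SH.F k → w ≢ v₀ → w ∈ F (inj₁ j)
      sub′ {w} w∈ w≢v₀ with punchView v₀ w
      ... | inj₁ w≡v₀ = contradiction w≡v₀ w≢v₀
      ... | inj₂ (w′ , refl) = ∈-insert⁺ v₀ _ outside (sub (∈-preimage⁺ (punchIn v₀) (SH.F k) w∈))
    -- The removed vertex is not `v₀`, which lies in the earlier facet, so facet `j` contains `v₀`
    -- and belongs to the second block.
    exchange {inj₂ i} {inj₂ k} v₀∈i v₀∈k (right i<k) with shelling-exchange SH i<k
    ... | j , _ , j<k , v , v∈ , v∉ , sub =
      inj₂ j , sub (x∈p∧x≢y⇒x∈p-y v₀∈k λ { refl → v∉ v₀∈i }) , right j<k , v , v∈ , v∉ , sub

    sorted : ∀ {x y} → P x → P y → x ≺ y → v₀ ∈ F x → v₀ ∈ F y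
    sorted {inj₁ i} _ _ _ v₀∈ = contradiction v₀∈ (v₀∉insert v₀ _)
    sorted {inj₂ i} {inj₂ j} _ v₀∈ _ _ = v₀∈

    split : Fin (SD.t + SH.t) → Index
    split = splitAt SD.t

    index : Index → Fin (SD.t + SH.t)
    index = join SD.t SH.t

    split-index : ∀ x → split (index x) ≡ x
    split-index = Fin.splitAt-join SD.t SH.t

  deletion-first : Ordering (independenceComplex H)
  deletion-first = record
    { N          = SD.t + SH.t
    ; F          = F ∘ split
    ; P          = P ∘ split
    ; P?         = P? ∘ split
    ; facet      = facet _
    ; distinct   = λ {i} {j} Pi Pj eq → trans (sym (Fin.join-splitAt SD.t SH.t i))
        (trans (cong index (distinct (split i) (split j) Pi Pj eq)) (Fin.join-splitAt SD.t SH.t j))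
    ; exhaustive = λ σ max → let x , Px , eq = exhaustive σ max in
        index x , subst P (sym (split-index x)) Px , trans (cong F (split-index x)) eq
    ; exchange   = λ {i} {k} Pi Pk i<k →
        let y , Py , y≺k , v , v∈ , v∉ , sub = exchange Pi Pk (splitAt-mono i<k) in
        index y , subst P (sym (split-index y)) Py ,
        subst (index y Fin.<_) (Fin.join-splitAt SD.t SH.t k) (join-mono y≺k) ,
        v , v∈ , v∉ , subst (λ z → F (split k) - v ⊆ F z) (sym (split-index y)) sub
    }

  deletion-first-sorted : Sorted deletion-first v₀
  deletion-first-sorted Pi Pk i<k = sorted Pi Pk (splitAt-mono i<k)

-- Index families as base-`N` numerals and the order for the glued graph

module _ {N : ℕ} where

  funToFin-mono : {f g : Fin m → Fin N} → (∀ u → f u Fin.≤ g u) → funToFin f Fin.≤ funToFin g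
  funToFin-mono {zero} f≤g = z≤n
  funToFin-mono {suc m} {f} {g} f≤g =
    subst₂ ℕ._≤_ (sym (Fin.toℕ-combine (f zero) (funToFin (f ∘ suc))))
                 (sym (Fin.toℕ-combine (g zero) (funToFin (g ∘ suc))))
      (ℕ.+-mono-≤ (ℕ.*-monoʳ-≤ (N ^ m) (f≤g zero)) (funToFin-mono (f≤g ∘ suc)))

  -- Pointwise agreement bounds each code by the other through `funToFin-mono`; antisymmetry
  -- concludes.
  finToFun-injective : {c d : Fin (N ^ m)} → (∀ u → finToFun {N} {m} c u ≡ finToFun {N} {m} d u) → c ≡ d
  finToFun-injective {m = m} {c} {d} eq =
    subst₂ _≡_ (Fin.funToFin-finToFin {m} c) (Fin.funToFin-finToFin {m} d) (Fin.≤-antisym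
      (funToFin-mono {m} λ u → ℕ.≤-reflexive (cong toℕ (eq u)))
      (funToFin-mono {m} λ u → ℕ.≤-reflexive (cong toℕ (sym (eq u)))))

  -- Contrapositive of `funToFin-mono`: if no digit of `d` exceeded that of `c`, then `d` would be
  -- at most `c`.
  finToFun-< : {c d : Fin (N ^ m)} → c Fin.< d → ∃ λ (u : Fin m) → finToFun c u Fin.< finToFun d u
  finToFun-< {m} {c} {d} c<d with Fin.any? (λ u → finToFun {N} {m} c u Fin.<? finToFun d u)
  ... | yes p = p
  ... | no ∄ = contradiction
    (subst₂ Fin._≤_ (Fin.funToFin-finToFin {m} d) (Fin.funToFin-finToFin {m} c)
      (funToFin-mono λ u → ℕ.≮⇒≥ λ lt → ∄ (u , lt)))
    (ℕ.<⇒≱ c<d)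

  replace : (Fin m → Fin N) → Fin m → Fin N → Fin m → Fin N
  replace g u j u′ with u Fin.≟ u′
  ... | yes _ = j
  ... | no _  = g u′

  replace-elim : (g : Fin m → Fin N) (u : Fin m) (j : Fin N) (Q : Fin m → Fin N → Set) →
                 Q u j → (∀ u′ → u ≢ u′ → Q u′ (g u′)) → ∀ u′ → Q u′ (replace g u j u′)
  replace-elim g u j Q at off u′ with u Fin.≟ u′
  ... | yes refl = at
  ... | no u≢u′ = off u′ u≢u′

  replace-at : (g : Fin m → Fin N) (u : Fin m) (j : Fin N) → replace g u j u ≡ j
  replace-at g u j with u Fin.≟ u
  ... | yes _ = refl
  ... | no u≢u = contradiction refl u≢u

  -- Monotonicity gives the weak inequality; it is strict because the changed digit can be read back
  -- from the code.
  funToFin-replace : (c : Fin (N ^ m)) (u : Fin m) {j : Fin N} → j Fin.< finToFun c u →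
                     funToFin (replace (finToFun c) u j) Fin.< c
  funToFin-replace {m} c u {j} j< = Fin.≤∧≢⇒<
    (subst (funToFin (replace g u j) Fin.≤_) (Fin.funToFin-finToFin {m} c)
      (funToFin-mono (replace-elim g u j (λ u′ i → i Fin.≤ g u′) (ℕ.<⇒≤ j<) λ _ _ → ℕ.≤-refl)))
    λ eq → Fin.<⇒≢ j< (trans (sym (replace-at g u j))
      (trans (sym (Fin.finToFun-funToFin (replace g u j) u)) (cong (λ d → finToFun {N} {m} d u) eq)))
    where
    g : Fin m → Fin N
    g = finToFun c

-- Facets of the glued graph are families of facets of H.  Lowering one entry
-- of a family lowers its position and, as the order is sorted, does not create
-- an occurrence of v₀, so the exchange property of H carries over entrywise.
module _ (G : Graph m) (H : Graph (suc n)) (v₀ : Fin (suc n)) (guarded : Guarded H v₀)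
         (O : Ordering (independenceComplex H)) (sorted : Sorted O v₀) where
  private
    module O = Ordering O
    GH = G [ H ⨾ v₀ ]

    decode : Fin (O.N ^ m) → Fin m → Fin O.N
    decode = finToFun

    family : Fin (O.N ^ m) → Fin m → Subset (suc n)
    family c u = O.F (decode c u)

    P : Pred (Fin (O.N ^ m)) 0ℓ
    P c = (∀ u → O.P (decode c u)) × Compatible G H v₀ (family c)

    P? : Decidable P
    P? c = Fin.all? (O.P? ∘ decode c) ×-dec compatible? G H v₀ (family c)

    family-injective : ∀ {c d} → P c → P d → glue (family c) ≡ glue (family d) → c ≡ d
    family-injective {c} {d} (Pc , _) (Pd , _) eq = finToFun-injective {m = m} λ u →
      O.distinct (Pc u) (Pd u) (trans (sym (slice-glue (family c) u))
        (trans (cong (λ σ → slice {m} σ u) eq) (slice-glue (family d) u)))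

    exhaustive : ∀ σ → MaximalIndependent GH σ → ∃[ c ] (P c × glue (family c) ≡ σ)
    exhaustive σ max = c , (Pc , com) , trans (glue-cong family≗) (glue-slice {m} σ)
      where
      found : ∀ u → ∃[ i ] (O.P i × O.F i ≡ slice σ u)
      found u = O.exhaustive (slice σ u) (slice-facet G H v₀ guarded max u)
      g : Fin m → Fin O.N
      g = proj₁ ∘ found
      c : Fin (O.N ^ m)
      c = funToFin g
      decode-c : ∀ u → decode c u ≡ g u
      decode-c = Fin.finToFun-funToFin g
      Pc : ∀ u → O.P (decode c u)
      Pc u = subst O.P (sym (decode-c u)) (proj₁ (proj₂ (found u)))
      family≗ : ∀ u → family c u ≡ slice σ u
      family≗ u = trans (cong O.F (decode-c u)) (proj₂ (proj₂ (found u)))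
      com : Compatible G H v₀ (family c)
      com u u′ u~u′ p q = slice-compatible G H v₀ (maximal⇒kernel GH max) u u′ u~u′
        (subst (v₀ ∈_) (family≗ u) p) (subst (v₀ ∈_) (family≗ u′) q)

    exchange : ∀ {c d} → P c → P d → c Fin.< d → Exchange P (glue ∘ family) c d
    exchange {c} {d} (Pc , _) (Pd , com) c<d
      with u , cu<du ← finToFun-< {m = m} c<d
      with j , Pj , j<du , x , x∈ , x∉ , sub ← O.exchange (Pc u) (Pd u) cu<du =
      e , (Pe , com′) , funToFin-replace d u j<du , combine u x ,
      ∈-glue⁺ (family d) x∈ , x∉ ∘ ∈-glue⁻ (family c) , p-x⊆q (combine u x) sub′
      where
      g : Fin m → Fin O.N
      g = replace (decode d) u j
      e : Fin (O.N ^ m)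
      e = funToFin g
      -- Decoding `e` agrees with `g` pointwise, so a property of each entry is proved for `g` and
      -- transported.
      by-cases : (Q : Fin m → Fin O.N → Set) → Q u j → (∀ u′ → u ≢ u′ → Q u′ (decode d u′)) →
                 ∀ u′ → Q u′ (decode e u′)
      by-cases Q at off u′ = subst (Q u′) (sym (Fin.finToFun-funToFin g u′))
        (replace-elim (decode d) u j Q at off u′)
      Pe : ∀ u′ → O.P (decode e u′)
      Pe = by-cases (λ _ → O.P) Pj (λ u′ _ → Pd u′)
      no-new-v₀ : ∀ u′ → v₀ ∈ family e u′ → v₀ ∈ family d u′
      no-new-v₀ = by-cases (λ u′ i → v₀ ∈ O.F i → v₀ ∈ family d u′)
        (sorted Pj (Pd u) j<du) (λ _ _ → id)
      com′ : Compatible G H v₀ (family e)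
      com′ u₁ u₂ u₁~u₂ p q = com u₁ u₂ u₁~u₂ (no-new-v₀ u₁ p) (no-new-v₀ u₂ q)
      sub′ : ∀ {y} → y ∈ glue (family d) → y ≢ combine u x → y ∈ glue (family e)
      sub′ {y} y∈ y≢ with u′ , v , refl ← Fin.combine-surjective {m} {suc n} y =
        ∈-glue⁺ (family e) (by-cases
          (λ u′ i → ∀ {v} → v ∈ family d u′ → combine u′ v ≢ combine u x → v ∈ O.F i)
          (λ v∈ ≢ → sub (x∈p∧x≢y⇒x∈p-y v∈ (≢ ∘ cong (combine u))))
          (λ _ _ v∈ _ → v∈) u′ (∈-glue⁻ (family d) y∈) y≢)

  glued-ordering : Ordering (independenceComplex GH)
  glued-ordering = record
    { N          = O.N ^ m
    ; F          = glue ∘ family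
    ; P          = P
    ; P?         = P?
    ; facet      = λ (Pc , com) → glue-facet G H v₀ (O.facet ∘ Pc) com
    ; distinct   = family-injective
    ; exhaustive = exhaustive
    ; exchange   = exchange
    }

-- Corresponding slices are facets of `H`, hence equal in size, and sizes add up over the copies.
glued-wellCovered : (G : Graph m) (H : Graph (suc n)) (v₀ : Fin (suc n)) → Guarded H v₀ →
                    WellCovered H → WellCovered (G [ H ⨾ v₀ ])
glued-wellCovered {m} G H v₀ guarded wc σ τ σ-max τ-max =
  subst₂ (λ p q → ∣ p ∣ ≡ ∣ q ∣) (glue-slice {m} σ) (glue-slice {m} τ)
    (∣glue∣-cong {m} (slice σ) (slice τ) λ u →
      wc _ _ (slice-facet G H v₀ guarded σ-max u) (slice-facet G H v₀ guarded τ-max u))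

-- Necessity, tested on a path, a single vertex and an edge

complete : ∀ m → Graph m
complete m = record
  { Adj    = _≢_
  ; adj?   = λ u v → ¬? (u Fin.≟ v)
  ; symm   = λ u≢v → u≢v ∘ sym
  ; irrefl = λ u≡v u≢v → u≢v u≡v
  }

P₃ : Graph 3
P₃ = record
  { Adj    = λ u v → (u ≡ mid × v ≢ mid) ⊎ (u ≢ mid × v ≡ mid)
  ; adj?   = λ u v → ((u Fin.≟ mid) ×-dec ¬? (v Fin.≟ mid)) ⊎-dec (¬? (u Fin.≟ mid) ×-dec (v Fin.≟ mid))
  ; symm   = λ { (inj₁ (p , q)) → inj₂ (q , p) ; (inj₂ (p , q)) → inj₁ (q , p) }
  ; irrefl = λ { refl (inj₁ (p , q)) → q p ; refl (inj₂ (p , q)) → p q }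
  }
  where
  mid : Fin 3
  mid = suc zero

-- If some maximal independent τ of H ∖ v₀ contained no neighbour of v₀, then
-- over P₃ the maximal independent sets {middle} and {ends} of P₃ would lift to
-- maximal independent sets with one, respectively two, copies of v₀.
module _ (H : Graph (suc n)) (v₀ : Fin (suc n)) (wc : WellCovered (P₃ [ H ⨾ v₀ ])) where

  wellCovered⇒guarded : Guarded H v₀
  wellCovered⇒guarded τ max with Fin.any? (λ v → (v ∈? τ) ×-dec Graph.adj? H v₀ (punchIn v₀ v))
  ... | yes p = p
  ... | no ∄ = contradiction a≡b (ℕ.<⇒≢ a<b)
    where
    ker : Kernel (H ∖ v₀) τ
    ker = maximal⇒kernel (H ∖ v₀) max

    τ⁻ τ⁺ : Subset (suc n)
    τ⁻ = insertAt τ v₀ outside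
    τ⁺ = insertAt τ v₀ inside

    a b : ℕ
    a = ∣ τ⁻ ∣
    b = ∣ τ⁺ ∣

    a<b : a ℕ.< b
    a<b = p⊂q⇒∣p∣<∣q∣ (sub , v₀ , v₀∈insert v₀ τ , v₀∉insert v₀ τ)
      where
      sub : τ⁻ ⊆ τ⁺
      sub {x} x∈ with punchView v₀ x
      ... | inj₁ refl = v₀∈insert v₀ τ
      ... | inj₂ (_ , refl) = ∈-insert⁺ v₀ τ inside (∈-insert⁻ v₀ τ outside x∈)

    lift : (Fin 3 → Side) → Fin 3 → Subset (suc n)
    lift s u = insertAt τ v₀ (s u)

    -- The side `s u` says whether copy `u` receives `v₀`. Adding `v₀` to `τ` is always allowed, as
    -- `τ` has no neighbour of it, and a missing `v₀` is dominated through `P₃`.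
    lift-maximal : ∀ s → (∀ u u′ → Adj P₃ u u′ → s u ≡ inside → s u′ ≢ inside) →
                   (∀ u → s u ≡ outside → ∃[ u′ ] (s u′ ≡ inside × Adj P₃ u u′)) →
                   MaximalIndependent (P₃ [ H ⨾ v₀ ]) (glue (lift s))
    lift-maximal s s-ind s-dom = kernel⇒maximal (P₃ [ H ⨾ v₀ ]) (glue-kernel P₃ H v₀ ind com dom)
      where
      ind : ∀ u → Independent H (lift s u)
      ind u with s u
      ... | inside  = insert-inside-independent H v₀ (proj₁ ker) λ v∈ v₀~v → ∄ (_ , v∈ , v₀~v)
      ... | outside = insert-outside-independent H v₀ (proj₁ ker)
      v₀∈⇒inside : ∀ u → v₀ ∈ lift s u → s u ≡ inside
      v₀∈⇒inside u v₀∈ = trans (sym (insertAt-lookup τ v₀ (s u))) ([]=⇒lookup v₀∈)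
      inside⇒v₀∈ : ∀ u → s u ≡ inside → v₀ ∈ lift s u
      inside⇒v₀∈ u eq = lookup⇒[]= v₀ _ (trans (insertAt-lookup τ v₀ (s u)) eq)
      com : Compatible P₃ H v₀ (lift s)
      com u u′ u~u′ p q = s-ind u u′ u~u′ (v₀∈⇒inside u p) (v₀∈⇒inside u′ q)
      dom : ∀ u v → v ∉ lift s u → Dominated P₃ H v₀ (lift s) u v
      dom u v v∉ with v Fin.≟ v₀
      ... | no v≢v₀ = inj₁ (insert-dominates H v₀ ker v v≢v₀ v∉)
      ... | yes refl with s u in eq
      ...   | inside = contradiction (v₀∈insert v₀ τ) v∉
      ...   | outside = let u′ , eq′ , u~u′ = s-dom u eq in
                        inj₂ (refl , u′ , inside⇒v₀∈ u′ eq′ , u~u′)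

    middle ends : Fin 3 → Side
    middle zero             = outside
    middle (suc zero)       = inside
    middle (suc (suc zero)) = outside
    ends zero             = inside
    ends (suc zero)       = outside
    ends (suc (suc zero)) = inside

    middle-maximal : MaximalIndependent (P₃ [ H ⨾ v₀ ]) (glue (lift middle))
    middle-maximal = lift-maximal middle
      (λ { (suc zero) (suc zero) (inj₁ (_ , ≢)) _ _ → ≢ refl
         ; (suc zero) (suc zero) (inj₂ (≢ , _)) _ _ → ≢ refl
         ; (suc zero) (suc (suc zero)) _ _ ()
         ; (suc (suc zero)) (suc zero) _ () })
      (λ { zero _ → suc zero , refl , inj₂ ((λ ()) , refl)
         ; (suc (suc zero)) _ → suc zero , refl , inj₂ ((λ ()) , refl) })

    ends-maximal : MaximalIndependent (P₃ [ H ⨾ v₀ ]) (glue (lift ends))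
    ends-maximal = lift-maximal ends
      (λ { zero _ (inj₁ (() , _)) ; zero _ (inj₂ (_ , refl)) _ ()
         ; (suc (suc zero)) _ (inj₁ (() , _)) ; (suc (suc zero)) _ (inj₂ (_ , refl)) _ () })
      (λ { (suc zero) _ → zero , refl , inj₁ (refl , λ ())
         ; (suc (suc zero)) () })

    size : ∀ s → ∣ glue (lift s) ∣ ≡ ∣ lift s zero ∣ + (∣ lift s (suc zero) ∣ + (∣ lift s (suc (suc zero)) ∣ + 0))
    size s = trans (∣glue∣ {2} f) (cong (λ c → ∣ f zero ∣ + c) (trans (∣glue∣ {1} (f ∘ suc))
      (cong (λ c → ∣ f (suc zero) ∣ + c) (∣glue∣ {0} (λ u → f (suc (suc u)))))))
      where
      f : Fin 3 → Subset (suc n)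
      f = lift s

    a≡b : a ≡ b
    -- The two lifts have sizes `a + b + a` and `b + a + b`; the common part `b + a` cancels.
    a≡b = ℕ.+-cancelʳ-≡ (b + a) a b (begin
      a + (b + a)       ≡⟨ cong (λ c → a + (b + c)) (sym (ℕ.+-identityʳ a)) ⟩
      a + (b + (a + 0)) ≡⟨ sym (size middle) ⟩
      _                 ≡⟨ wc _ _ middle-maximal ends-maximal ⟩
      _                 ≡⟨ size ends ⟩
      b + (a + (b + 0)) ≡⟨ cong (λ c → b + (a + c)) (ℕ.+-identityʳ b) ⟩
      b + (a + b)       ≡⟨ cong (λ c → b + c) (ℕ.+-comm a b) ⟩
      b + (b + a)       ∎)
      where open ≡-Reasoning

module _ (H : Graph (suc n)) (v₀ : Fin (suc n)) (guarded : Guarded H v₀) where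
  private
    K₁H = complete 1 [ H ⨾ v₀ ]
    K₂H = complete 2 [ H ⨾ v₀ ]

    single : Subset (suc n) → Fin 1 → Subset (suc n)
    single σ _ = σ

    single-maximal : ∀ {σ} → MaximalIndependent H σ → MaximalIndependent K₁H (glue (single σ))
    single-maximal max = glue-facet (complete 1) H v₀ (λ _ → max)
      λ { zero zero ≢ → contradiction refl ≢ }

  complete₁-wellCovered : WellCovered K₁H → WellCovered H
  complete₁-wellCovered wc σ τ σ-max τ-max = ℕ.+-cancelʳ-≡ 0 _ _
    (trans (sym (∣glue∣ (single σ)))
      (trans (wc _ _ (single-maximal σ-max) (single-maximal τ-max)) (∣glue∣ (single τ))))

  -- The link of the empty face is the whole complex, so here the link construction merely relabels
  -- vertices.
  complete₁-ordering : Shellable K₁H → Ordering (independenceComplex H)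
  complete₁-ordering S = link-ordering S (combine {1} zero)
    (λ {v} {w} → Fin.combine-injectiveʳ {1} zero v zero w) ⊥
    cover
    (λ max _ → slice-facet (complete 1) H v₀ guarded max zero)
    (λ {σ} max → glue (single σ) , single-maximal max , (λ x∈⊥ → contradiction x∈⊥ ∉⊥) ,
      slice-glue (single σ) zero)
    where
    cover : ∀ {F} → MaximalIndependent K₁H F → ⊥ ⊆ F → ∀ {x} → x ∈ F →
            x ∈ ⊥ ⊎ (∃[ v ] combine {1} zero v ≡ x)
    cover _ _ {x} _ with zero , v , refl ← Fin.combine-surjective {1} {suc n} x = inj₂ (v , refl)

  private
    pair : Subset (suc n) → Subset (suc n) → Fin 2 → Subset (suc n)
    pair σ τ zero       = σ
    pair σ τ (suc zero) = τ

    -- A maximal independent set of K₂H that restricts to a fixed facet ρ ∋ v₀ on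
    -- the first copy of H restricts to an arbitrary facet avoiding v₀ on the second.
    module _ {ρ} (v₀∈ρ : v₀ ∈ ρ) (ρ-max : MaximalIndependent H ρ) where

      ρ₁ : Subset (2 * suc n)
      ρ₁ = glue (pair ρ ⊥)

      second : Fin n → Fin (2 * suc n)
      second = combine {2} (suc zero) ∘ punchIn v₀

      module _ {F} (max : MaximalIndependent K₂H F) (ρ₁⊆F : ρ₁ ⊆ F) where

        -- The first slice is independent and contains the maximal `ρ`, so it equals `ρ`.
        slice₀ : slice {2} F zero ⊆ ρ
        slice₀ = ⊆-reflexive (sym (proj₂ ρ-max (slice {2} F zero)
          (proj₁ (slice-facet (complete 2) H v₀ guarded max zero))
          λ v∈ρ → ∈-preimage⁺ (combine {2} zero) F (ρ₁⊆F (∈-glue⁺ (pair ρ ⊥) {zero} v∈ρ))))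

        -- The first copy already uses `v₀`, and the edge of `complete 2` forbids it in the second.
        v₀∉slice₁ : v₀ ∉ slice {2} F (suc zero)
        v₀∉slice₁ = slice-compatible (complete 2) H v₀ (maximal⇒kernel K₂H max) zero (suc zero) (λ ())
          (∈-preimage⁺ (combine {2} zero) F (ρ₁⊆F (∈-glue⁺ (pair ρ ⊥) {zero} v₀∈ρ)))

        second-covers : ∀ {x} → x ∈ F → x ∈ ρ₁ ⊎ (∃[ v ] second v ≡ x)
        second-covers {x} x∈ with Fin.combine-surjective {2} {suc n} x
        ... | zero , v , refl =
          inj₁ (∈-glue⁺ (pair ρ ⊥) {zero} (slice₀ (∈-preimage⁺ (combine {2} zero) F x∈)))
        ... | suc zero , v , refl with punchView v₀ v
        ... | inj₁ refl = contradiction (∈-preimage⁺ (combine {2} (suc zero)) F x∈) v₀∉slice₁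
        ... | inj₂ (j , refl) = inj₂ (j , refl)

        second-facet : MaximalIndependent (H ∖ v₀) (preimage second F)
        second-facet = subst (MaximalIndependent (H ∖ v₀)) eq (kernel⇒maximal (H ∖ v₀)
          (delete-kernel H v₀ (proj₁ ker) v₀∉slice₁ λ v _ → proj₂ ker v))
          where
          ker : Kernel H (slice {2} F (suc zero))
          ker = maximal⇒kernel H (slice-facet (complete 2) H v₀ guarded max (suc zero))
          eq : delete v₀ (slice {2} F (suc zero)) ≡ preimage second F
          eq = tabulate-cong λ j → lookup∘tabulate (lookup F ∘ combine {2} (suc zero)) (punchIn v₀ j)

      -- By the neighbour condition `σ` is maximal in `H` too, and since it avoids `v₀` it can be
      -- placed beside `ρ`.
      second-facet⁻ : ∀ {σ} → MaximalIndependent (H ∖ v₀) σ →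
                      ∃[ F ] (MaximalIndependent K₂H F × ρ₁ ⊆ F × preimage second F ≡ σ)
      second-facet⁻ {σ} max = glue f , glue-facet (complete 2) H v₀ f-max f-compatible , sub , eq
        where
        f : Fin 2 → Subset (suc n)
        f = pair ρ (insertAt σ v₀ outside)
        f-max : ∀ u → MaximalIndependent H (f u)
        f-max zero       = ρ-max
        f-max (suc zero) = kernel⇒maximal H
          (insert-kernel H v₀ guarded (maximal⇒kernel (H ∖ v₀) max))
        f-compatible : Compatible (complete 2) H v₀ f
        f-compatible zero       zero       ≢ = contradiction refl ≢
        f-compatible zero       (suc zero) _ _ = v₀∉insert v₀ σ
        f-compatible (suc zero) _          _ v₀∈ = contradiction v₀∈ (v₀∉insert v₀ σ)
        sub : ρ₁ ⊆ glue f
        sub {x} x∈ with Fin.combine-surjective {2} {suc n} x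
        ... | zero , v , refl = ∈-glue⁺ f {zero} (∈-glue⁻ (pair ρ ⊥) {zero} x∈)
        ... | suc zero , v , refl = contradiction (∈-glue⁻ (pair ρ ⊥) {suc zero} x∈) ∉⊥
        eq : preimage second (glue f) ≡ σ
        eq = trans (tabulate-cong λ j → lookup-glue f (suc zero) (punchIn v₀ j))
                   (delete-insert v₀ σ outside)

      second-ordering : Shellable K₂H → Ordering (independenceComplex (H ∖ v₀))
      second-ordering S = link-ordering S second
        (λ {i} {j} → Fin.punchIn-injective v₀ i j
          ∘ Fin.combine-injectiveʳ {2} (suc zero) (punchIn v₀ i) (suc zero) (punchIn v₀ j))
        ρ₁ second-covers second-facet second-facet⁻

  complete₂-ordering : Shellable K₂H → Ordering (independenceComplex (H ∖ v₀))
  -- Any facet through `v₀` can serve as `ρ`; one arises by extending the singleton.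
  complete₂-ordering S with extend-maximal (independent? H) {⁅ v₀ ⁆} (λ u∈ v∈ →
    Graph.irrefl H (trans (x∈⁅y⁆⇒x≡y v₀ u∈) (sym (x∈⁅y⁆⇒x≡y v₀ v∈))))
  ... | ρ , v₀⊆ρ , ρ-max = second-ordering (v₀⊆ρ (x∈⁅x⁆ v₀)) ρ-max S

theorem1p2 : ∀ (n : ℕ) (H : Graph (suc n)) (v₀ : Fin (suc n)) →
    (∀ (m : ℕ) (G : Graph m) → WellCovered (G [ H ⨾ v₀ ]) × Shellable (G [ H ⨾ v₀ ]))
    ⇔
    (WellCovered H × (Shellable H × Shellable (H ∖ v₀)) ×
    (∀ (τ : Subset n) → MaximalIndependent (H ∖ v₀) τ →
    ∃[ v ] (v ∈ τ × Adj H v₀ (punchIn v₀ v))))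
theorem1p2 n H v₀ = mk⇔ to from
  where
  to : (∀ m (G : Graph m) → WellCovered (G [ H ⨾ v₀ ]) × Shellable (G [ H ⨾ v₀ ])) →
       WellCovered H × (Shellable H × Shellable (H ∖ v₀)) × Guarded H v₀
  to all =
    complete₁-wellCovered H v₀ guarded (proj₁ (all 1 (complete 1))) ,
    (ordering⇒shelling (complete₁-ordering H v₀ guarded (proj₂ (all 1 (complete 1)))) ,
     ordering⇒shelling (complete₂-ordering H v₀ guarded (proj₂ (all 2 (complete 2))))) ,
    guarded
    where
    -- The neighbour condition makes slices of facets into facets of `H`, on which both orderings
    -- rely.
    guarded : Guarded H v₀
    guarded = wellCovered⇒guarded H v₀ (proj₁ (all 3 P₃))

  from : WellCovered H × (Shellable H × Shellable (H ∖ v₀)) × Guarded H v₀ →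
         ∀ m (G : Graph m) → WellCovered (G [ H ⨾ v₀ ]) × Shellable (G [ H ⨾ v₀ ])
  from (wc , (SH , SD) , guarded) m G =
    glued-wellCovered G H v₀ guarded wc ,
    ordering⇒shelling (glued-ordering G H v₀ guarded
      (deletion-first H v₀ guarded SH SD) (deletion-first-sorted H v₀ guarded SH SD))
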